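{- Let $X$ be a finite set. Two operations $\ast,\star\in\mathcal{M}(X)$ are $\mathcal{R}$-equivalent if and only if $\pi_\ast=\pi_\star$.
   Context: $\mathcal{M}(X)=X^{X\times X}$ is the set of all binary operations on $X$, a monoid under $\triangleright$ defined by $a(\circ\triangleright\ast)b=(a\circ b)\ast(b\circ a)$ for all $a,b\in X$, with identity $a\circ_{lz}b=a$. The right Green's relation $\mathcal{R}$: $\ast\,\mathcal{R}\,\star$ iff $\ast\mathcal{M}(X)=\star\mathcal{M}(X)$, where $\ast\mathcal{M}(X)=\{\ast\triangleright\circ:\circ\in\mathcal{M}(X)\}$. For $\ast\in\mathcal{M}(X)$ let $T_\ast(a,b)=(a\ast b,b\ast a)$, and let $\pi_\ast$ be the equivalence relation on $X\times X$ defined by $(a,b)\,\pi_\ast\,(u,v)\iff T_\ast(a,b)=T_\ast(u,v)$. -}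

module Defs where

open import Algebra.Bundles using (Monoid)
open import Algebra.Core using (Op₂)
open import Data.Fin.Base using (Fin)
open import Data.Nat.Base using (ℕ)
open import Data.Product.Base using (_×_; _,_; ∃)
open import Function.Base using (_on_)
open import Function.Bundles using (_↔_)
open import Level using (Level; _⊔_)
open import Relation.Binary.Core using (Rel)
open import Relation.Binary.PropositionalEquality
  using (_≡_; refl; sym; trans; cong₂)
open import Relation.Unary using (Pred; _≐_)

private
  variable
    a c ℓ : Level

Finite : Set a → Set a
Finite X = ∃ λ (n : ℕ) → X ↔ Fin n

module Green (M : Monoid c ℓ) where
  open Monoid M

  rightIdeal : Carrier → Pred Carrier (c ⊔ ℓ)
  rightIdeal x y = ∃ λ z → y ≈ x ∙ z

  infix 4 _ℛ_

  _ℛ_ : Rel Carrier (c ⊔ ℓ)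
  x ℛ y = rightIdeal x ≐ rightIdeal y

module _ {X : Set a} where

  infixl 7 _▷_
  infix 4 _≋_

  _▷_ : Op₂ X → Op₂ X → Op₂ X
  (_∘_ ▷ _∗_) x y = (x ∘ y) ∗ (y ∘ x)

  lz : Op₂ X
  lz x y = x

  -- Without function extensionality, operations are compared pointwise.
  _≋_ : Rel (Op₂ X) a
  _∘_ ≋ _∗_ = ∀ x y → x ∘ y ≡ x ∗ y

  T : Op₂ X → X × X → X × X
  T _∗_ (x , y) = x ∗ y , y ∗ x

  π : Op₂ X → Rel (X × X) a
  π _∗_ = _≡_ on T _∗_

𝓜 : (X : Set a) → Monoid a a
𝓜 X = record
  { Carrier  = Op₂ X
  ; _≈_      = _≋_
  ; _∙_      = _▷_
  ; ε        = lz
  ; isMonoid = record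
    { isSemigroup = record
      { isMagma = record
        { isEquivalence = record
          { refl  = λ x y → refl
          ; sym   = λ p x y → sym (p x y)
          ; trans = λ p q x y → trans (p x y) (q x y)
          }
        ; ∙-cong = λ {_} {_} {_} {_∗_} p q x y →
            trans (q _ _) (cong₂ _∗_ (p x y) (p y x))
        }
      ; assoc = λ _ _ _ x y → refl
      }
    ; identity = (λ _ x y → refl) , (λ _ x y → refl)
    }
  }

{-# OPTIONS --safe #-}
-- If π ∗ ⊆ π ⋆, then ⋆ factors through T ∗: send (c , d) to x ⋆ y for any
-- preimage (x , y) of (c , d) under T ∗, and to c off the image of T ∗.
-- Finiteness makes membership in that image decidable and supplies the preimage.
module Submission where

open import Defs
open import Algebra.Bundles using (Monoid)
open import Algebra.Core using (Op₂)
open import Data.Fin.Properties using (any?; inj⇒≟)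
open import Data.Product.Base using (_,_; ∃; proj₁)
open import Data.Product.Properties using (≡-dec)
open import Function.Bundles using (_⇔_; mk⇔; Inverse)
open import Function.Properties.Inverse using (↔⇒↣)
open import Level using (Level)
open import Relation.Binary.Definitions using (DecidableEquality)
open import Relation.Binary.PropositionalEquality
  using (_≡_; refl; sym; trans; cong; cong₂; subst)
open import Relation.Nullary.Decidable using (Dec; yes; no; map′)
open import Relation.Nullary.Negation using (contradiction)
open import Relation.Unary using (Pred; Decidable; _⊆_)
import Relation.Binary.Core as Rel₂

private
  variable
    a c p ℓ : Level
    X : Set a

Finite⇒≟ : Finite X → DecidableEquality X
Finite⇒≟ (_ , X↔Fin) = inj⇒≟ (↔⇒↣ X↔Fin)

Finite⇒any? : Finite X → {P : Pred X p} → Decidable P → Dec (∃ P)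
Finite⇒any? (_ , X↔Fin) {P} P? =
  map′ (λ (i , Pi) → from i , Pi)
       (λ (x , Px) → to x , subst P (sym (strictlyInverseʳ x)) Px)
       (any? (λ i → P? (from i)))
  where open Inverse X↔Fin

module _ {X : Set a} where
  open Green (𝓜 X) using (rightIdeal)

  T-image? : Finite X → (∗ : Op₂ X) → Decidable (λ q → ∃ λ r → T ∗ r ≡ q)
  T-image? fin ∗ q =
    -- Finiteness is given for `X` only, so `X × X` is searched one coordinate at a time.
    map′ (λ (x , y , eq) → (x , y) , eq)
         (λ ((x , y) , eq) → x , y , eq)
         (Finite⇒any? fin λ x → Finite⇒any? fin λ y →
           ≡-dec (Finite⇒≟ fin) (Finite⇒≟ fin) (T ∗ (x , y)) q)

  π-⇒⇒rightIdeal : Finite X → (∗ ⋆ : Op₂ X) → π ∗ Rel₂.⇒ π ⋆ → rightIdeal ∗ ⋆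
  π-⇒⇒rightIdeal fin ∗ ⋆ π∗⇒π⋆ = _∘_ , factors
    where
    _∘_ : Op₂ X
    u ∘ v with T-image? fin ∗ (u , v)
    ... | yes ((x , y) , _) = ⋆ x y
    ... | no  _             = u

    factors : ⋆ ≋ (∗ ▷ _∘_)
    factors x y with T-image? fin ∗ (T ∗ (x , y))
    -- The preimage found may differ from `(x , y)`, but the two are `π ∗`-related, hence
    -- `π ⋆`-related, so `⋆` takes the same value at both.
    ... | yes (_ , eq) = cong proj₁ (sym (π∗⇒π⋆ eq))
    ... | no ∉image    = contradiction ((x , y) , refl) ∉image

  -- `T` turns `▷` into composition of maps, so `T ⋆` is `T ∗` followed by `T ∘`, and postcomposing
  -- can only enlarge the kernel.
  rightIdeal⇒π-⇒ : (∗ ⋆ : Op₂ X) → rightIdeal ∗ ⋆ → π ∗ Rel₂.⇒ π ⋆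
  rightIdeal⇒π-⇒ ∗ ⋆ (∘ , ⋆≋∗▷∘) {x , y} {u , v} eq =
    trans (T-factors x y) (trans (cong (T ∘) eq) (sym (T-factors u v)))
    where
    T-factors : ∀ x y → T ⋆ (x , y) ≡ T ∘ (T ∗ (x , y))
    T-factors x y = cong₂ _,_ (⋆≋∗▷∘ x y) (⋆≋∗▷∘ y x)

module _ (M : Monoid c ℓ) where
  open Monoid M hiding (refl; sym; trans)
  open Green M

  rightIdeal-refl : ∀ x → rightIdeal x x
  rightIdeal-refl x = ε , Monoid.sym M (identityʳ x)

  -- By associativity, inclusion of principal right ideals reduces to membership of the generator.
  rightIdeal-trans : ∀ {x y} → rightIdeal x y → rightIdeal y ⊆ rightIdeal x
  rightIdeal-trans {x} (u , y≈xu) (v , z≈yv) =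
    u ∙ v , Monoid.trans M z≈yv (Monoid.trans M (∙-congʳ y≈xu) (assoc x u v))

corollary13 : ∀ {a} {X : Set a} → Finite X → (∗ ⋆ : Op₂ X) →
    (Green._ℛ_ (𝓜 X) ∗ ⋆) ⇔ (π ∗ Rel₂.⇔ π ⋆)
corollary13 {X = X} fin ∗ ⋆ = mk⇔
  -- The correspondence reverses order: the smaller right ideal has the coarser kernel. Hence the
  -- inclusions pair up crosswise in both directions.
  (λ (∗M⊆⋆M , ⋆M⊆∗M) →
    rightIdeal⇒π-⇒ ∗ ⋆ (⋆M⊆∗M (rightIdeal-refl (𝓜 X) ⋆)) ,
    rightIdeal⇒π-⇒ ⋆ ∗ (∗M⊆⋆M (rightIdeal-refl (𝓜 X) ∗)))
  (λ (π∗⇒π⋆ , π⋆⇒π∗) →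
    rightIdeal-trans (𝓜 X) (π-⇒⇒rightIdeal fin ⋆ ∗ π⋆⇒π∗) ,
    rightIdeal-trans (𝓜 X) (π-⇒⇒rightIdeal fin ∗ ⋆ π∗⇒π⋆))
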